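{- For every $n\ge1$, $\mathsf{CG}^{\mathrm{ns}}(\text{Promise- }\mathsf{OR}_n)\geq n$.
   Context: $[n]=\{1,\dots,n\}$. $\text{Promise- }\mathsf{OR}_n$ is the restriction of the OR function on $n$ bits to the inputs of Hamming weight $0$ or $1$: it equals $0$ on $0^n$, equals $1$ on each string of Hamming weight exactly $1$, and is undefined on all other strings. For a partial Boolean function $f$ on $n$ bits, a non-signaling strategy is a family of probability distributions $p(\cdot,\cdot|x,y)$ on $[n]\times[n]$, for $x\in f^{ -1}(0),y\in f^{ -1}(1)$, such that $\sum_b p(a,b|x,y)=\sum_b p(a,b|x,y')$ and $\sum_a p(a,b|x,y)=\sum_a p(a,b|x',y)$ for all $x,x'\in f^{ -1}(0)$, $y,y'\in f^{ -1}(1)$, $a,b\in[n]$. The non-signaling certificate game complexity is $$\mathsf{CG}^{\mathrm{ns}}(f)=\min_p\max_{x\in f^{ -1}(0),y\in f^{ -1}(1)}\Big(\sum_{i:x_i\ne y_i}p(i,i|x,y)\Big)^{ -1}$$ over non-signaling strategies $p$, with $1/0=+\infty$. -}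

module Defs where

open import Algebra.Bundles using (CommutativeRing)
open import Algebra.Core using (Op₁)
open import Data.Bool using (Bool; true; false; if_then_else_)
import Data.Bool as Bool
open import Data.Fin using (Fin)
open import Data.Maybe using (Maybe; just; nothing)
open import Data.Nat using (ℕ; zero; suc)
open import Data.Product using (Σ; ∃; _×_; _,_; proj₁)
open import Data.Vec using (Vec; lookup; count)
open import Level using (Level; _⊔_) renaming (suc to lsuc)
open import Relation.Binary using (Rel; IsDecTotalOrder)
open import Relation.Binary.PropositionalEquality using (_≡_)
open import Relation.Nullary using (does)
open import Relation.Nullary.Construct.Add.Supremum using (_⁺; ⊤⁺; [_])
import Algebra.Definitions.RawMonoid as RawMonoidDefs
import Relation.Binary.Construct.Add.Supremum.Equality as SupEquality
import Relation.Binary.Construct.Add.Supremum.NonStrict as SupOrder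

-- The scalars.  The library has no real numbers, so everything below is
-- stated over an arbitrary (decidably, totally) ordered field; the classical
-- field of real numbers and ℚ are instances.  `_⁻¹` is total, but nothing is
-- assumed about the inverse of 0#.

record OrderedField (c ℓ₁ ℓ₂ : Level) : Set (lsuc (c ⊔ ℓ₁ ⊔ ℓ₂)) where
  infix 8 _⁻¹
  infix 4 _≤_
  field
    commutativeRing : CommutativeRing c ℓ₁

  open CommutativeRing commutativeRing public

  field
    _⁻¹             : Op₁ Carrier
    0≉1             : 0# ≉ 1#
    ⁻¹-inverseʳ     : ∀ x → x ≉ 0# → x * x ⁻¹ ≈ 1#
    _≤_             : Rel Carrier ℓ₂
    isDecTotalOrder : IsDecTotalOrder _≈_ _≤_
    +-monoˡ-≤       : ∀ {x y} z → x ≤ y → x + z ≤ y + z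
    *-nonNeg        : ∀ {x y} → 0# ≤ x → 0# ≤ y → 0# ≤ x * y

  open IsDecTotalOrder isDecTotalOrder public
    using (_≟_; _≤?_)

PartialBoolFun : ℕ → Set
PartialBoolFun n = Vec Bool n → Maybe Bool

Preimage : ∀ {n} → PartialBoolFun n → Bool → Set
Preimage {n} f b = Σ (Vec Bool n) λ x → f x ≡ just b

hammingWeight : ∀ {n} → Vec Bool n → ℕ
hammingWeight = count (Bool._≟ true)

Promise-OR : ∀ n → PartialBoolFun n
Promise-OR n x = byWeight (hammingWeight x)
  where
  byWeight : ℕ → Maybe Bool
  byWeight 0             = just false
  byWeight 1             = just true
  byWeight (suc (suc _)) = nothing

module CertificateGame {c ℓ₁ ℓ₂ : Level} (K : OrderedField c ℓ₁ ℓ₂) where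

  open OrderedField K
  open RawMonoidDefs +-rawMonoid using (sum) renaming (_×_ to _×ᴷ_)

  -- Carrier ⁺ is Carrier with +∞ (written ⊤⁺) adjoined on top.
  open SupEquality _≈_ public using (_≈⁺_)
  open SupOrder _≤_ public using (_≤⁺_)

  fromℕ⁺ : ℕ → Carrier ⁺
  fromℕ⁺ n = [ n ×ᴷ 1# ]

  inv⁺ : Carrier → Carrier ⁺
  inv⁺ x = if does (x ≟ 0#) then ⊤⁺ else [ x ⁻¹ ]

  IsGreatest : ∀ {a : Level} → (Carrier ⁺ → Set a) → Carrier ⁺ → Set (c ⊔ ℓ₂ ⊔ a)
  IsGreatest S m = S m × (∀ v → S v → v ≤⁺ m)

  IsLeast : ∀ {a : Level} → (Carrier ⁺ → Set a) → Carrier ⁺ → Set (c ⊔ ℓ₂ ⊔ a)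
  IsLeast S m = S m × (∀ v → S v → m ≤⁺ v)

  module _ {n : ℕ} (f : PartialBoolFun n) where

    record NonSignalingStrategy : Set (c ⊔ ℓ₁ ⊔ ℓ₂) where
      field
        -- p x y a b is the probability p(a, b | x, y).
        p      : Preimage f false → Preimage f true → Fin n → Fin n → Carrier
        nonNeg : ∀ x y a b → 0# ≤ p x y a b
        total  : ∀ x y → sum (λ a → sum (λ b → p x y a b)) ≈ 1#
        nsA    : ∀ x y y′ a → sum (λ b → p x y a b) ≈ sum (λ b → p x y′ a b)
        nsB    : ∀ x x′ y b → sum (λ a → p x y a b) ≈ sum (λ a → p x′ y a b)

    open NonSignalingStrategy

    -- The sum of p(i, i | x, y) over the i with x i ≠ y i.
    winProb : NonSignalingStrategy → Preimage f false → Preimage f true → Carrier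
    winProb s x y = sum λ i →
      if does (lookup (proj₁ x) i Bool.≟ lookup (proj₁ y) i)
      then 0# else p s x y i i

    IsCost : NonSignalingStrategy → Carrier ⁺ → Set (c ⊔ ℓ₁ ⊔ ℓ₂)
    IsCost s = IsGreatest λ v → ∃ λ x → ∃ λ y → v ≈⁺ inv⁺ (winProb s x y)

    -- v is the non-signaling certificate game complexity of f: the minimum
    -- over strategies of the maximum over input pairs.  Such a v is unique up
    -- to _≈⁺_, so "the complexity of f satisfies P" is "some v with
    -- IsCGns v satisfies P", which includes the attainment of the minimum.
    IsCGns : Carrier ⁺ → Set (c ⊔ ℓ₁ ⊔ ℓ₂)
    IsCGns = IsLeast λ v → ∃ λ s → IsCost s v

{-# OPTIONS --safe #-}

-- On the input pair (0ⁿ, eⱼ) the players win exactly with the answers (j, j),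
-- so the winning probability is at most Alice's marginal at j.  By
-- non-signaling this marginal does not depend on eⱼ, and summed over j it
-- gives 1; hence some winning probability is at most 1/n.  Drawing a common
-- uniform answer from shared randomness attains 1/n, so the minimum is n.

module Submission where

open import Defs
open import Data.Bool using (Bool; true; false; if_then_else_)
import Data.Bool as Bool
open import Data.Empty using (⊥-elim)
open import Data.Fin as Fin using (Fin; zero; suc)
open import Data.Fin.Properties using (punchInᵢ≢i)
open import Data.Maybe using (just)
open import Data.Nat using (ℕ; zero; suc; pred; _≥_)
open import Data.Product using (∃; _×_; _,_; proj₁; proj₂)
open import Data.Sum using (inj₁; inj₂)
open import Data.Vec using (Vec; []; _∷_; lookup; replicate; _[_]≔_)
open import Data.Vec.Properties using (lookup-replicate; lookup∘update; lookup∘update′)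
open import Function using (_∘_)
open import Relation.Binary.Bundles using (Poset)
open import Relation.Binary.PropositionalEquality as ≡ using (_≡_; _≢_)
open import Relation.Binary.Structures using (IsDecTotalOrder)
open import Relation.Nullary using (does; yes; no)
open import Relation.Nullary.Decidable using (dec-true; dec-false)
open import Relation.Nullary.Construct.Add.Supremum using (⊤⁺; [_])
import Algebra.Properties.CommutativeMonoid.Sum as CommutativeMonoidSum
import Algebra.Properties.Ring as RingProperties
import Algebra.Properties.Semiring.Mult as SemiringMult
import Algebra.Properties.Semiring.Sum as SemiringSum
import Relation.Binary.Construct.Add.Supremum.Equality as SupEquality
import Relation.Binary.Construct.Add.Supremum.NonStrict as SupOrder
import Relation.Binary.Reasoning.PartialOrder as PartialOrderReasoning

-- The two fibres of `Promise-OR`: the zero vector and the unit vectors.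

zeros : ∀ n → Vec Bool n
zeros n = replicate n false

unit : ∀ {n} → Fin n → Vec Bool n
unit j = zeros _ [ j ]≔ true

hammingWeight-zeros : ∀ n → hammingWeight (zeros n) ≡ 0
hammingWeight-zeros zero    = ≡.refl
hammingWeight-zeros (suc n) = hammingWeight-zeros n

hammingWeight-unit : ∀ {n} (j : Fin n) → hammingWeight (unit j) ≡ 1
hammingWeight-unit {suc n} zero    = ≡.cong suc (hammingWeight-zeros n)
hammingWeight-unit         (suc j) = hammingWeight-unit j

hammingWeight≡0⇒zeros : ∀ {n} (x : Vec Bool n) → hammingWeight x ≡ 0 → x ≡ zeros n
hammingWeight≡0⇒zeros []          _ = ≡.refl
hammingWeight≡0⇒zeros (false ∷ x) w = ≡.cong (false ∷_) (hammingWeight≡0⇒zeros x w)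

hammingWeight≡1⇒unit : ∀ {n} (x : Vec Bool n) → hammingWeight x ≡ 1 → ∃ λ j → x ≡ unit j
hammingWeight≡1⇒unit (true ∷ x) w =
  zero , ≡.cong (true ∷_) (hammingWeight≡0⇒zeros x (≡.cong pred w))
hammingWeight≡1⇒unit (false ∷ x) w with hammingWeight≡1⇒unit x w
... | j , x≡ = suc j , ≡.cong (false ∷_) x≡

zeros∈false : ∀ n → Promise-OR n (zeros n) ≡ just false
zeros∈false n rewrite hammingWeight-zeros n = ≡.refl

unit∈true : ∀ {n} (j : Fin n) → Promise-OR n (unit j) ≡ just true
unit∈true j rewrite hammingWeight-unit j = ≡.refl

false⇒zeros : ∀ {n} (x : Vec Bool n) → Promise-OR n x ≡ just false → x ≡ zeros n
-- Abstracting the weight lets `Promise-OR n x` reduce, while `w` keeps the equation that identifies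
-- `x`.
false⇒zeros x fx with hammingWeight x in w
... | 0 = hammingWeight≡0⇒zeros x w
false⇒zeros x () | 1
false⇒zeros x () | suc (suc _)

true⇒unit : ∀ {n} (x : Vec Bool n) → Promise-OR n x ≡ just true → ∃ λ j → x ≡ unit j
true⇒unit x fx with hammingWeight x in w
... | 1 = hammingWeight≡1⇒unit x w
true⇒unit x () | 0
true⇒unit x () | suc (suc _)

-- Inequalities and inverses in an ordered field.

module OrderedFieldProperties {c ℓ₁ ℓ₂} (K : OrderedField c ℓ₁ ℓ₂) where

  open OrderedField K hiding (zero)
  open IsDecTotalOrder isDecTotalOrder using ()
    renaming (isPartialOrder to ≤-isPartialOrder; total to ≤-total; antisym to ≤-antisym)
  open RingProperties ring using (-‿distribˡ-*; -‿distribʳ-*; -‿involutive)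
  open CommutativeMonoidSum +-commutativeMonoid
  open SemiringMult semiring using () renaming (_×_ to _×ᴷ_)

  ≤-poset : Poset c ℓ₁ ℓ₂
  ≤-poset = record { isPartialOrder = ≤-isPartialOrder }

  open PartialOrderReasoning ≤-poset

  +-monoʳ-≤ : ∀ {x y} z → x ≤ y → z + x ≤ z + y
  +-monoʳ-≤ {x} {y} z x≤y = begin
    z + x ≈⟨ +-comm z x ⟩
    x + z ≤⟨ +-monoˡ-≤ z x≤y ⟩
    y + z ≈⟨ +-comm y z ⟩
    z + y ∎

  +-mono-≤ : ∀ {x y u v} → x ≤ y → u ≤ v → x + u ≤ y + v
  +-mono-≤ {x} {y} {u} {v} x≤y u≤v = begin
    x + u ≤⟨ +-monoˡ-≤ u x≤y ⟩
    y + u ≤⟨ +-monoʳ-≤ y u≤v ⟩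
    y + v ∎

  x≤x+y : ∀ x {y} → 0# ≤ y → x ≤ x + y
  x≤x+y x {y} 0≤y = begin
    x      ≈⟨ +-identityʳ x ⟨
    x + 0# ≤⟨ +-monoʳ-≤ x 0≤y ⟩
    x + y  ∎

  x≤y⇒0≤y-x : ∀ {x y} → x ≤ y → 0# ≤ y - x
  x≤y⇒0≤y-x {x} {y} x≤y = begin
    0#    ≈⟨ -‿inverseʳ x ⟨
    x - x ≤⟨ +-monoˡ-≤ (- x) x≤y ⟩
    y - x ∎

  -- The difference `z * (y - x)` is a product of non-negative factors.
  *-monoʳ-≤ : ∀ {x y z} → 0# ≤ z → x ≤ y → z * x ≤ z * y
  *-monoʳ-≤ {x} {y} {z} 0≤z x≤y = begin
    z * x                 ≤⟨ x≤x+y (z * x) (*-nonNeg 0≤z (x≤y⇒0≤y-x x≤y)) ⟩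
    z * x + z * (y - x)   ≈⟨ distribˡ z x (y - x) ⟨
    z * (x + (y - x))     ≈⟨ *-congˡ (+-comm x (y - x)) ⟩
    z * ((y - x) + x)     ≈⟨ *-congˡ (+-assoc y (- x) x) ⟩
    z * (y + (- x + x))   ≈⟨ *-congˡ (+-congˡ (-‿inverseˡ x)) ⟩
    z * (y + 0#)          ≈⟨ *-congˡ (+-identityʳ y) ⟩
    z * y                 ∎

  -- By totality either `x` or `- x` is non-negative, and both have the same square.
  square-nonNeg : ∀ x → 0# ≤ x * x
  square-nonNeg x with ≤-total 0# x
  ... | inj₁ 0≤x = *-nonNeg 0≤x 0≤x
  ... | inj₂ x≤0 = begin
    0#            ≤⟨ *-nonNeg 0≤-x 0≤-x ⟩
    - x * - x     ≈⟨ -‿distribˡ-* x (- x) ⟨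
    - (x * - x)   ≈⟨ -‿cong (-‿distribʳ-* x x) ⟨
    - - (x * x)   ≈⟨ -‿involutive (x * x) ⟩
    x * x         ∎
    where
    0≤-x : 0# ≤ - x
    0≤-x = begin
      0#     ≤⟨ x≤y⇒0≤y-x x≤0 ⟩
      0# - x ≈⟨ +-identityˡ (- x) ⟩
      - x    ∎

  0≤1 : 0# ≤ 1#
  0≤1 = begin
    0#      ≤⟨ square-nonNeg 1# ⟩
    1# * 1# ≈⟨ *-identityˡ 1# ⟩
    1#      ∎

  xy≈1⇒x≉0 : ∀ {x y} → x * y ≈ 1# → x ≉ 0#
  xy≈1⇒x≉0 {x} {y} xy≈1 x≈0 = 0≉1 (begin-equality
    0#     ≈⟨ zeroˡ y ⟨
    0# * y ≈⟨ *-congʳ x≈0 ⟨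
    x * y  ≈⟨ xy≈1 ⟩
    1#     ∎)

  ⁻¹-unique : ∀ {x y} → x * y ≈ 1# → x ⁻¹ ≈ y
  ⁻¹-unique {x} {y} xy≈1 = begin-equality
    x ⁻¹             ≈⟨ *-identityʳ _ ⟨
    x ⁻¹ * 1#        ≈⟨ *-congˡ xy≈1 ⟨
    x ⁻¹ * (x * y)   ≈⟨ *-assoc _ x y ⟨
    (x ⁻¹ * x) * y   ≈⟨ *-congʳ (*-comm _ x) ⟩
    (x * x ⁻¹) * y   ≈⟨ *-congʳ (⁻¹-inverseʳ x (xy≈1⇒x≉0 xy≈1)) ⟩
    1# * y           ≈⟨ *-identityˡ y ⟩
    y                ∎

  -- The inverse is `x` times the square of `x ⁻¹`.
  ⁻¹-nonNeg : ∀ {x} → x ≉ 0# → 0# ≤ x → 0# ≤ x ⁻¹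
  ⁻¹-nonNeg {x} x≉0 0≤x = begin
    0#                   ≤⟨ *-nonNeg 0≤x (square-nonNeg (x ⁻¹)) ⟩
    x * (x ⁻¹ * x ⁻¹)    ≈⟨ *-assoc x _ _ ⟨
    (x * x ⁻¹) * x ⁻¹    ≈⟨ *-congʳ (⁻¹-inverseʳ x x≉0) ⟩
    1# * x ⁻¹            ≈⟨ *-identityˡ _ ⟩
    x ⁻¹                 ∎

  n×1-nonNeg : ∀ n → 0# ≤ n ×ᴷ 1#
  n×1-nonNeg zero    = Poset.refl ≤-poset
  n×1-nonNeg (suc n) = begin
    0#            ≤⟨ 0≤1 ⟩
    1#            ≤⟨ x≤x+y 1# (n×1-nonNeg n) ⟩
    1# + n ×ᴷ 1#  ∎

  -- Characteristic zero: otherwise `1# ≤ 0#`, and antisymmetry with `0≤1` would identify `0#` and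
  -- `1#`.
  1+n×1≉0 : ∀ n → suc n ×ᴷ 1# ≉ 0#
  1+n×1≉0 n n≈0 = 0≉1 (≤-antisym 0≤1 (begin
    1#            ≤⟨ x≤x+y 1# (n×1-nonNeg n) ⟩
    1# + n ×ᴷ 1#  ≈⟨ n≈0 ⟩
    0#            ∎))

  -- Order properties of finite sums.

  sum-mono-≤ : ∀ {n} {f g : Fin n → Carrier} → (∀ i → f i ≤ g i) → sum f ≤ sum g
  sum-mono-≤ {zero}  f≤g = Poset.refl ≤-poset
  sum-mono-≤ {suc n} f≤g = +-mono-≤ (f≤g zero) (sum-mono-≤ (f≤g ∘ suc))

  sum-nonNeg : ∀ {n} {f : Fin n → Carrier} → (∀ i → 0# ≤ f i) → 0# ≤ sum f
  sum-nonNeg {n} {f} 0≤f = begin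
    0#                    ≈⟨ sum-replicate-zero n ⟨
    sum {n} (λ _ → 0#)    ≤⟨ sum-mono-≤ 0≤f ⟩
    sum f                 ∎

  term≤sum : ∀ {n} {f : Fin n → Carrier} → (∀ i → 0# ≤ f i) → ∀ j → f j ≤ sum f
  term≤sum {suc n} {f} 0≤f j = begin
    f j                                ≤⟨ x≤x+y (f j) (sum-nonNeg (λ i → 0≤f (Fin.punchIn j i))) ⟩
    f j + sum (f ∘ Fin.punchIn j)      ≈⟨ sum-remove {i = j} f ⟨
    sum f                              ∎

  sum-single : ∀ {n} {f : Fin n → Carrier} j → (∀ i → i ≢ j → f i ≈ 0#) → sum f ≈ f j
  sum-single {suc n} {f} j f≈0 = begin-equality
    sum f                            ≈⟨ sum-remove {i = j} f ⟩
    f j + sum (f ∘ Fin.punchIn j)    ≈⟨ +-congˡ (sum-cong-≋ (λ i → f≈0 _ (punchInᵢ≢i j i))) ⟩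
    f j + sum {n} (λ _ → 0#)         ≈⟨ +-congˡ (sum-replicate-zero n) ⟩
    f j + 0#                         ≈⟨ +-identityʳ (f j) ⟩
    f j                              ∎

module PromiseORGame {c ℓ₁ ℓ₂} (K : OrderedField c ℓ₁ ℓ₂) where

  open OrderedField K hiding (zero)
  open CertificateGame K
  open OrderedFieldProperties K
  open CommutativeMonoidSum +-commutativeMonoid
  open SemiringMult semiring using (×-assoc-*) renaming (_×_ to _×ᴷ_; ×-congʳ to ×ᴷ-congʳ)
  open SemiringSum semiring using (*-distribʳ-sum)
  open SupEquality _≈_ using (≈⁺-refl; ≈⁺-sym; ≈⁺-trans)
  open SupOrder _≤_ using (≤⁺-reflexive)
  open PartialOrderReasoning ≤-poset
  open NonSignalingStrategy

  -- Inverses with values in the extended scalars.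

  xy≈1⇒inv⁺ : ∀ {x y} → x * y ≈ 1# → inv⁺ x ≈⁺ [ y ]
  xy≈1⇒inv⁺ {x} xy≈1 with x ≟ 0#
  ... | yes x≈0 = ⊥-elim (xy≈1⇒x≉0 xy≈1 x≈0)
  ... | no  _   = SupEquality.[ ⁻¹-unique xy≈1 ]

  inv⁺≤⇒0≤ : ∀ {x w} → 0# ≤ x → inv⁺ x ≤⁺ [ w ] → 0# ≤ w
  inv⁺≤⇒0≤ {x} 0≤x le with x ≟ 0#
  -- No case `x ≈ 0#` remains: there `inv⁺ x` is `⊤⁺`, which does not lie below a finite `[ w ]`.
  inv⁺≤⇒0≤ {x} {w} 0≤x SupOrder.[ x⁻¹≤w ] | no x≉0 = begin
    0#   ≤⟨ ⁻¹-nonNeg x≉0 0≤x ⟩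
    x ⁻¹ ≤⟨ x⁻¹≤w ⟩
    w    ∎

  -- Clearing the inverse makes the cost bound linear in `x`, so that it can be summed over many
  -- input pairs.
  inv⁺≤⇒1≤* : ∀ {x w} → 0# ≤ x → inv⁺ x ≤⁺ [ w ] → 1# ≤ x * w
  inv⁺≤⇒1≤* {x} 0≤x le with x ≟ 0#
  inv⁺≤⇒1≤* {x} {w} 0≤x SupOrder.[ x⁻¹≤w ] | no x≉0 = begin
    1#       ≈⟨ ⁻¹-inverseʳ x x≉0 ⟨
    x * x ⁻¹ ≤⟨ *-monoʳ-≤ 0≤x x⁻¹≤w ⟩
    x * w    ∎

  -- Winning probabilities on the promise inputs.

  module _ {n : ℕ} where

    zerosᵖ : Preimage (Promise-OR n) false
    zerosᵖ = zeros n , zeros∈false n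

    unitᵖ : Fin n → Preimage (Promise-OR n) true
    unitᵖ j = unit j , unit∈true j

    -- The inputs differ at `j` only, so a single term survives. Only the vector of `y` is
    -- constrained, so no two membership proofs have to be compared.
    winProb-unit : ∀ s x y j → proj₁ y ≡ unit j →
                   winProb (Promise-OR n) s x y ≈ p s x y j j
    winProb-unit s (x , fx) y@(_ , _) j ≡.refl with false⇒zeros x fx
    ... | ≡.refl = begin-equality
      sum term      ≈⟨ sum-single j off ⟩
      term j        ≡⟨ diag ⟩
      p s _ y j j   ∎
      where
      term : Fin n → Carrier
      term i = if does (lookup (zeros n) i Bool.≟ lookup (unit j) i)
               then 0# else p s (zeros n , fx) y i i

      off : ∀ i → i ≢ j → term i ≈ 0#
      off i i≢j rewrite lookup∘update′ i≢j (zeros n) true | lookup-replicate i false = refl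

      diag : term j ≡ p s (zeros n , fx) y j j
      diag rewrite lookup∘update j (zeros n) true | lookup-replicate j false = ≡.refl

  -- The lower bound for every strategy, with `n` positive.

  module _ {m : ℕ} where

    private
      n : ℕ
      n = suc m

    winProb-sum≤1 : ∀ s → sum {n} (λ j → winProb (Promise-OR n) s zerosᵖ (unitᵖ j)) ≤ 1#
    winProb-sum≤1 s = begin
      sum (λ j → winProb _ s zerosᵖ (unitᵖ j))
        ≈⟨ sum-cong-≋ {n} (λ j → winProb-unit s zerosᵖ (unitᵖ j) j ≡.refl) ⟩
      sum (λ j → p s zerosᵖ (unitᵖ j) j j)
        ≤⟨ sum-mono-≤ (λ j → term≤sum (nonNeg s zerosᵖ (unitᵖ j) j) j) ⟩
      sum (λ j → sum (p s zerosᵖ (unitᵖ j) j))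
        -- `unitᵖ zero` is an arbitrary reference input, available since `n` is a successor; all
        -- marginals now belong to one distribution.
        ≈⟨ sum-cong-≋ (λ j → nsA s zerosᵖ (unitᵖ j) (unitᵖ zero) j) ⟩
      sum (λ j → sum (p s zerosᵖ (unitᵖ zero) j))
        ≈⟨ total s zerosᵖ (unitᵖ zero) ⟩
      1# ∎

    -- Instead of selecting a worst `j`, the bounds `1# ≤ win j * w` are added up, and the winning
    -- probabilities sum to at most `1#`.
    n≤cost : ∀ s v → IsCost (Promise-OR n) s v → fromℕ⁺ n ≤⁺ v
    n≤cost s ⊤⁺    _            = _ SupOrder.≤⊤⁺
    n≤cost s [ w ] (_ , cost≤w) = SupOrder.[ (begin
      n ×ᴷ 1#                ≈⟨ sum-replicate n ⟨
      sum {n} (λ _ → 1#)     ≤⟨ sum-mono-≤ (λ j → inv⁺≤⇒1≤* (win-nonNeg j) (inv⁺-win≤w j)) ⟩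
      sum (λ j → win j * w)  ≈⟨ *-distribʳ-sum w win ⟨
      sum win * w            ≈⟨ *-comm (sum win) w ⟩
      -- Monotonicity needs `0# ≤ w`, which the bound at any one index supplies.
      w * sum win            ≤⟨ *-monoʳ-≤ (inv⁺≤⇒0≤ (win-nonNeg zero) (inv⁺-win≤w zero))
                                          (winProb-sum≤1 s) ⟩
      w * 1#                 ≈⟨ *-identityʳ w ⟩
      w                      ∎) ]
      where
      win : Fin n → Carrier
      win j = winProb (Promise-OR n) s zerosᵖ (unitᵖ j)

      win-nonNeg : ∀ j → 0# ≤ win j
      win-nonNeg j = begin
        0#                           ≤⟨ nonNeg s zerosᵖ (unitᵖ j) j j ⟩
        p s zerosᵖ (unitᵖ j) j j     ≈⟨ winProb-unit s zerosᵖ (unitᵖ j) j ≡.refl ⟨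
        win j                        ∎

      inv⁺-win≤w : ∀ j → inv⁺ (win j) ≤⁺ [ w ]
      inv⁺-win≤w j = cost≤w _ (zerosᵖ , unitᵖ j , ≈⁺-refl refl)

    -- A strategy attaining the bound.

    private
      1/n : Carrier
      1/n = (n ×ᴷ 1#) ⁻¹

      n*1/n≈1 : n ×ᴷ 1# * 1/n ≈ 1#
      n*1/n≈1 = ⁻¹-inverseʳ (n ×ᴷ 1#) (1+n×1≉0 m)

    -- Uniform on the diagonal, not on all pairs: both players output the same random index.
    uniform : Fin n → Fin n → Carrier
    uniform a b = if does (a Fin.≟ b) then 1/n else 0#

    uniform-diag : ∀ a → uniform a a ≡ 1/n
    uniform-diag a rewrite dec-true (a Fin.≟ a) ≡.refl = ≡.refl

    uniform-marginal : ∀ a → sum (uniform a) ≈ 1/n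
    uniform-marginal a = begin-equality
      sum (uniform a) ≈⟨ sum-single a off ⟩
      uniform a a     ≡⟨ uniform-diag a ⟩
      1/n             ∎
      where
      off : ∀ b → b ≢ a → uniform a b ≈ 0#
      off b b≢a rewrite dec-false (a Fin.≟ b) (b≢a ∘ ≡.sym) = refl

    uniformStrategy : NonSignalingStrategy (Promise-OR n)
    uniformStrategy = record
      { p      = λ _ _ → uniform
      ; nonNeg = λ _ _ → uniform-nonNeg
      ; total  = λ _ _ → uniform-total
      ; nsA    = λ _ _ _ _ → refl
      ; nsB    = λ _ _ _ _ → refl
      }
      where
      uniform-nonNeg : ∀ a b → 0# ≤ uniform a b
      uniform-nonNeg a b with does (a Fin.≟ b)
      ... | true  = ⁻¹-nonNeg (1+n×1≉0 m) (n×1-nonNeg n)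
      ... | false = Poset.refl ≤-poset

      uniform-total : sum (λ a → sum (uniform a)) ≈ 1#
      uniform-total = begin-equality
        sum (λ a → sum (uniform a)) ≈⟨ sum-cong-≋ uniform-marginal ⟩
        sum {n} (λ _ → 1/n)         ≈⟨ sum-replicate n ⟩
        n ×ᴷ 1/n                    ≈⟨ ×ᴷ-congʳ n (*-identityˡ 1/n) ⟨
        n ×ᴷ (1# * 1/n)             ≈⟨ ×-assoc-* n 1# 1/n ⟨
        n ×ᴷ 1# * 1/n               ≈⟨ n*1/n≈1 ⟩
        1#                          ∎

    -- Every input `y` is some `unit j`, so the winning probability is `1/n` on all pairs and the
    -- maximum is over a constant.
    uniformStrategy-inv⁺ : ∀ x y → inv⁺ (winProb (Promise-OR n) uniformStrategy x y) ≈⁺ fromℕ⁺ n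
    uniformStrategy-inv⁺ x y with true⇒unit (proj₁ y) (proj₂ y)
    ... | j , y≡ = xy≈1⇒inv⁺ (begin-equality
      winProb _ uniformStrategy x y * n ×ᴷ 1#  ≈⟨ *-congʳ (winProb-unit uniformStrategy x y j y≡) ⟩
      uniform j j * n ×ᴷ 1#                    ≡⟨ ≡.cong (_* n ×ᴷ 1#) (uniform-diag j) ⟩
      1/n * n ×ᴷ 1#                            ≈⟨ *-comm 1/n (n ×ᴷ 1#) ⟩
      n ×ᴷ 1# * 1/n                            ≈⟨ n*1/n≈1 ⟩
      1#                                       ∎)

    uniformStrategy-cost : IsCost (Promise-OR n) uniformStrategy (fromℕ⁺ n)
    uniformStrategy-cost =
        (zerosᵖ , unitᵖ zero , ≈⁺-sym sym (uniformStrategy-inv⁺ zerosᵖ (unitᵖ zero)))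
      , λ { v (x , y , v≈) → ≤⁺-reflexive (Poset.reflexive ≤-poset)
              (≈⁺-trans trans v≈ (uniformStrategy-inv⁺ x y)) }

    CGns-Promise-OR : IsCGns (Promise-OR n) (fromℕ⁺ n)
    CGns-Promise-OR =
        (uniformStrategy , uniformStrategy-cost)
      , λ { v (s , cost) → n≤cost s v cost }

proposition6p1 : ∀ {c ℓ₁ ℓ₂} (K : OrderedField c ℓ₁ ℓ₂) → let open CertificateGame K in
    ∀ (n : ℕ) → n ≥ 1 → ∃ λ v → IsCGns (Promise-OR n) v × fromℕ⁺ n ≤⁺ v
-- The complexity is exactly `n`, so the required inequality is reflexivity.
proposition6p1 K (suc m) _ = fromℕ⁺ (suc m) , CGns-Promise-OR , SupOrder.[ ≤-refl ]
  where
  open CertificateGame K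
  open PromiseORGame K
  open Poset (OrderedFieldProperties.≤-poset K) using () renaming (refl to ≤-refl)
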